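{- There are infinitely many, pairwise inequivalent up to scaling, trinomials $x^6+Ax+B$ with $A,B\in\mathbb{Q}$, $AB\neq0$, having reducibility type $(1,2,3)$. There are no trinomials $x^6+Ax+B$ with $A,B\in\mathbb{Q}$, $AB\neq0$, having reducibility type $(1,1,1,3)$.
   Context: A monic polynomial in $\mathbb{Q}[x]$ has reducibility type $(n_1,\dots,n_k)$, $n_1\le\dots\le n_k$, if it factors as a product of $k$ irreducible polynomials in $\mathbb{Q}[x]$ (not necessarily distinct) of degrees $n_1,\dots,n_k$. Two trinomials $x^n+Ax^m+B$ and $x^n+A'x^m+B'$ are equivalent up to scaling if $A'=A\lambda^{n-m}$ and $B'=B\lambda^n$ for some $\lambda\in\mathbb{Q}\setminus\{0\}$. -}

module Defs where

open import Algebra.Bundles.Raw using (RawSemiring)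
open import Data.List.Base using (List; []; _∷_; map; foldr)
open import Data.List.Relation.Binary.Pointwise.Base using (Pointwise)
open import Data.List.Relation.Unary.All using (All)
open import Data.List.Relation.Unary.Linked using (Linked)
open import Data.Nat.Base using (ℕ; zero; suc; _∸_; _≤_; _<_)
open import Data.Product.Base using (_×_; _,_; ∃-syntax)
open import Data.Rational.Base using (ℚ; 0ℚ; 1ℚ; _+_; _*_; +-*-rawSemiring)
open import Level using (0ℓ)
open import Relation.Binary.PropositionalEquality.Core using (_≡_; _≢_)

import Algebra.Definitions.RawSemiring as RawSemiringDefinitions

open RawSemiringDefinitions +-*-rawSemiring using () renaming (_^_ to _^ℚ_)

-- Elements of ℚ[x]: coefficient lists, constant term first.  Trailing zeros
-- are allowed, so equality of polynomials is _≈ₚ_ rather than _≡_.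
Poly : Set
Poly = List ℚ

coeff : Poly → ℕ → ℚ
coeff []      _       = 0ℚ
coeff (a ∷ p) zero    = a
coeff (a ∷ p) (suc k) = coeff p k

infix  4 _≈ₚ_
infixl 6 _+ₚ_
infixl 7 _*ₚ_

_≈ₚ_ : Poly → Poly → Set
p ≈ₚ q = ∀ k → coeff p k ≡ coeff q k

_+ₚ_ : Poly → Poly → Poly
[]      +ₚ q       = q
(a ∷ p) +ₚ []      = a ∷ p
(a ∷ p) +ₚ (b ∷ q) = (a + b) ∷ (p +ₚ q)

-- (a + x p) q = a q + x (p q)
_*ₚ_ : Poly → Poly → Poly
[]      *ₚ q = []
(a ∷ p) *ₚ q = map (a *_) q +ₚ (0ℚ ∷ (p *ₚ q))

const : ℚ → Poly
const a = a ∷ []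

X : Poly
X = 0ℚ ∷ 1ℚ ∷ []

polyRawSemiring : RawSemiring 0ℓ 0ℓ
polyRawSemiring = record
  { Carrier = Poly
  ; _≈_     = _≈ₚ_
  ; _+_     = _+ₚ_
  ; _*_     = _*ₚ_
  ; 0#      = []
  ; 1#      = const 1ℚ
  }

open RawSemiringDefinitions polyRawSemiring public
  using (Irreducible) renaming (_^_ to _^ₚ_)

productₚ : List Poly → Poly
productₚ = foldr _*ₚ_ (const 1ℚ)

-- The zero polynomial has no degree.
HasDegree : Poly → ℕ → Set
HasDegree p n = coeff p n ≢ 0ℚ × (∀ {k} → n < k → coeff p k ≡ 0ℚ)

Monic : Poly → Set
Monic p = ∃[ n ] (HasDegree p n × coeff p n ≡ 1ℚ)

record HasReducibilityType (p : Poly) (ns : List ℕ) : Set where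
  field
    monic       : Monic p
    sorted      : Linked _≤_ ns
    factors     : List Poly
    irreducible : All Irreducible factors
    degrees     : Pointwise HasDegree factors ns
    factorises  : p ≈ₚ productₚ factors

-- x ^ n + A x ^ m + B
trinomial : (n m : ℕ) → ℚ × ℚ → Poly
trinomial n m (A , B) = X ^ₚ n +ₚ const A *ₚ X ^ₚ m +ₚ const B

-- Relates trinomial n m (A , B) to trinomial n m (A′ , B′).  Intended for
-- m ≤ n, where n ∸ m is the true difference.
EquivalentUpToScaling : (n m : ℕ) → ℚ × ℚ → ℚ × ℚ → Set
EquivalentUpToScaling n m (A , B) (A′ , B′) =
  ∃[ c ] (c ≢ 0ℚ × A′ ≡ A * c ^ℚ (n ∸ m) × B′ ≡ B * c ^ℚ n)

{-# OPTIONS --safe #-}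

module Submission where

-- Type (1,1,1,3): if (x − a)(x − b)(x − c) divides x⁶ + Ax + B, the vanishing of the
-- coefficients of x², …, x⁵ forces h₄(a,b,c) = 0 for the complete homogeneous symmetric
-- polynomial h₄.  But 2h₄ = a⁴ + b⁴ + c⁴ + (a² + b² + c²)(a + b + c)² is positive definite.
--
-- Type (1,2,3): the trinomials divisible by some (x − a)(x² − sx + p) correspond to rational
-- points of the elliptic curve y² = x³ + 3x + 1.  Take the points (−2)ⁿ⁺¹(0,1).  Modulo 3 they
-- all agree, and the quadratic and the cubic factor are irreducible there.  The 2-adic valuation
-- of their denominators strictly increases with n; it determines the valuation of A while B
-- remains odd, so A⁶/B⁵, which is invariant under scaling, separates the trinomials.

open import Defs
open import Data.Fin.Base using (Fin; toℕ; fromℕ<)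
import Data.Fin.Properties as Fin
open import Data.List.Base using (List; []; _∷_; map)
open import Data.Nat.Base as ℕ using (ℕ; zero; suc; z≤n; s≤s)
import Data.Nat.Divisibility as ℕ
import Data.Nat.Properties as ℕ
open import Data.Product.Base using (_×_; _,_; ∃-syntax; Σ-syntax; proj₁; proj₂; map₂)
open import Data.Sum.Base using (_⊎_; inj₁; inj₂; [_,_]′)
open import Function.Base using (_∘_; id)
open import Relation.Binary.PropositionalEquality
open import Relation.Nullary using (¬_; yes; no; contradiction)

module Integers where
  open import Data.Integer.Base hiding (suc)
  open import Data.Integer.DivMod using (_/ℕ_; n%ℕd<d; a≡a%ℕn+[a/ℕn]*n)
  open import Data.Integer.Properties
  open import Data.Integer.Tactic.RingSolver using (solve-∀)
  open import Relation.Nullary using (_×-dec_; _→-dec_)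
  open import Relation.Nullary.Decidable using (from-yes; from-no)

  -- Congruences between integers.

  infix 4 _≋_[mod_]
  record _≋_[mod_] (a b m : ℤ) : Set where
    constructor congruent
    field
      quotient : ℤ
      equality : a ≡ b + quotient * m

  ≋-reflexive : ∀ {m a b} → a ≡ b → a ≋ b [mod m ]
  ≋-reflexive {m} {a} refl = congruent 0ℤ (identity a m)
    where
    identity : ∀ a m → a ≡ a + 0ℤ * m
    identity = solve-∀

  ≋-refl : ∀ {m a} → a ≋ a [mod m ]
  ≋-refl = ≋-reflexive refl

  ≋-sym : ∀ {m a b} → a ≋ b [mod m ] → b ≋ a [mod m ]
  ≋-sym {m} {a} {b} (congruent k refl) = congruent (- k) (identity b k m)
    where
    identity : ∀ b k m → b ≡ b + k * m + (- k) * m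
    identity = solve-∀

  ≋-trans : ∀ {m a b c} → a ≋ b [mod m ] → b ≋ c [mod m ] → a ≋ c [mod m ]
  ≋-trans {m} {c = c} (congruent k refl) (congruent l refl) = congruent (l + k) (identity c k l m)
    where
    identity : ∀ c k l m → c + l * m + k * m ≡ c + (l + k) * m
    identity = solve-∀

  infixl 6 _+≋_ _-≋_
  infixl 7 _*≋_
  infix  8 -≋_

  _+≋_ : ∀ {m a b c d} → a ≋ b [mod m ] → c ≋ d [mod m ] → a + c ≋ b + d [mod m ]
  _+≋_ {m} {b = b} {d = d} (congruent k refl) (congruent l refl) =
    congruent (k + l) (identity b d k l m)
    where
    identity : ∀ b d k l m → b + k * m + (d + l * m) ≡ b + d + (k + l) * m
    identity = solve-∀

  -≋_ : ∀ {m a b} → a ≋ b [mod m ] → - a ≋ - b [mod m ]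
  -≋_ {m} {b = b} (congruent k refl) = congruent (- k) (identity b k m)
    where
    identity : ∀ b k m → - (b + k * m) ≡ - b + (- k) * m
    identity = solve-∀

  _-≋_ : ∀ {m a b c d} → a ≋ b [mod m ] → c ≋ d [mod m ] → a - c ≋ b - d [mod m ]
  a≋b -≋ c≋d = a≋b +≋ (-≋ c≋d)

  _*≋_ : ∀ {m a b c d} → a ≋ b [mod m ] → c ≋ d [mod m ] → a * c ≋ b * d [mod m ]
  _*≋_ {m} {b = b} {d = d} (congruent k refl) (congruent l refl) =
    congruent (b * l + k * d + k * l * m) (identity b d k l m)
    where
    identity : ∀ b d k l m → (b + k * m) * (d + l * m) ≡
      b * d + (b * l + k * d + k * l * m) * m
    identity = solve-∀

  ≋0⇒∣ : ∀ {a m} → a ≋ 0ℤ [mod m ] → ∣ m ∣ ℕ.∣ ∣ a ∣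
  ≋0⇒∣ {m = m} (congruent k refl) = ℕ.divides ∣ k ∣
    (trans (cong ∣_∣ (+-identityˡ (k * m))) (abs-* k m))

  residue : ∀ m .{{_ : ℕ.NonZero m}} a → ∃[ i ] a ≋ + toℕ {m} i [mod + m ]
  residue m a = fromℕ< (n%ℕd<d a m) ,
    subst (λ i → a ≋ + i [mod + m ]) (sym (Fin.toℕ-fromℕ< (n%ℕd<d a m)))
    (congruent (a /ℕ m) (a≡a%ℕn+[a/ℕn]*n a m))

  -- Integer polynomials, their homogenisations and products.

  -- The exponent of d is the length of the list, one above the formal degree, so that the recursion
  -- also covers the empty list.
  degreePower : List ℤ → ℤ → ℤ
  degreePower []      d = 1ℤ
  degreePower (a ∷ l) d = d * degreePower l d

  -- d times the homogenisation of a nonzero l.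
  homogenise : List ℤ → ℤ → ℤ → ℤ
  homogenise []      n d = 0ℤ
  homogenise (a ∷ l) n d = a * (d * degreePower l d) + n * homogenise l n d

  coeffℤ : List ℤ → ℕ → ℤ
  coeffℤ []      k       = 0ℤ
  coeffℤ (a ∷ l) zero    = a
  coeffℤ (a ∷ l) (suc k) = coeffℤ l k

  -- The second factor is a coefficient sequence, so that products nest and each coefficient unfolds
  -- to an expression accessible to the ring solver.
  convolve : List ℤ → (ℕ → ℤ) → ℕ → ℤ
  convolve []      c k       = 0ℤ
  convolve (a ∷ l) c zero    = a * c 0
  convolve (a ∷ l) c (suc k) = a * c (suc k) + convolve l c k

  -- The elliptic curve and its sequence of points.

  weierstrass : ℤ → ℤ → ℤ
  weierstrass x z = x * x * x + + 3 * x * z * z + z * z * z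

  -- Numerators of the coordinates of −2(x/z², y/z³), as functions of x and z².
  double-x double-y : ℤ → ℤ → ℤ
  double-x x z = x * x * x * x - + 6 * x * x * z * z - + 8 * x * z * z * z + + 9 * z * z * z * z
  double-y x z = + 35 * z * z * z * z * z * z + + 12 * x * z * z * z * z * z + + 45 * x * x * z * z * z * z
    - + 20 * x * x * x * z * z * z - + 15 * x * x * x * x * z * z - x * x * x * x * x * x

  -- With z standing for the square of the denominator, y enters the duplication formula only
  -- through y², which W replaces. The curve equation for -2P thus becomes a polynomial identity in
  -- two free variables.
  duplication : ∀ x z →
    let W  = x * x * x + + 3 * x * z * z + z * z * z
        X′ = x * x * x * x - + 6 * x * x * z * z - + 8 * x * z * z * z + + 9 * z * z * z * z
        Y′ = + 35 * z * z * z * z * z * z + + 12 * x * z * z * z * z * z + + 45 * x * x * z * z * z * z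
             - + 20 * x * x * x * z * z * z - + 15 * x * x * x * x * z * z - x * x * x * x * x * x
        Z′ = + 4 * W * z
    in Y′ * Y′ ≡ X′ * X′ * X′ + + 3 * X′ * Z′ * Z′ + Z′ * Z′ * Z′
  duplication = solve-∀

  Odd : ℤ → Set
  Odd a = a ≋ 1ℤ [mod + 2 ]

  2*≋0 : ∀ a → + 2 * a ≋ 0ℤ [mod + 2 ]
  2*≋0 a = congruent a (identity a)
    where
    identity : ∀ a → + 2 * a ≡ 0ℤ + a * + 2
    identity = solve-∀

  -- The point (x/z², y/z³) of y² = x³ + 3x + 1.
  record CurvePoint (n : ℕ) : Set where
    field
      x y t : ℤ
    -- With `t` odd, the 2-adic valuation of `z` is exactly n + 1, so the index can be recovered
    -- from the point.
    z = (+ 2) ^ suc n * t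
    w = y * z
    field
      on-curve : y * y ≡ weierstrass x (z * z)
      x-odd    : Odd x
      y-odd    : Odd y
      t-odd    : Odd t
      -- The factors depend on the point only through `x`, `z * z` and `w`; the separate signs of
      -- `y` and `z` modulo 3 are left open.
      x≋0      : x ≋ 0ℤ [mod + 3 ]
      z²≋1     : z * z ≋ 1ℤ [mod + 3 ]
      w≋1      : w ≋ 1ℤ [mod + 3 ]

    z-even : z ≋ 0ℤ [mod + 2 ]
    z-even = ≋-trans (≋-reflexive (*-assoc (+ 2) ((+ 2) ^ n) t)) (2*≋0 ((+ 2) ^ n * t))

  -- −2(0,1) = (9/4, 35/8)
  initial : CurvePoint 0
  initial = record
    { x = + 9 ; y = + 35 ; t = 1ℤ
    ; on-curve = refl
    ; x-odd = congruent (+ 4) refl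
    ; y-odd = congruent (+ 17) refl
    ; t-odd = ≋-refl
    ; x≋0 = congruent (+ 3) refl
    ; z²≋1 = congruent (+ 1) refl
    ; w≋1 = congruent (+ 23) refl
    }

  -- P ↦ −2P rather than P ↦ 2P: the former fixes the residue class of a point modulo 3.
  double : ∀ {n} → CurvePoint n → CurvePoint (suc n)
  double {n} P = record
    { x = double-x x Z ; y = double-y x Z ; t = y * t
    ; on-curve = trans (duplication x Z) (cong (weierstrass (double-x x Z)) (sym z′²))
    ; x-odd = double-x-≋ x-odd Z-even
    ; y-odd = ≋-trans (double-y-≋ x-odd Z-even) (congruent (- 1ℤ) refl)
    ; t-odd = y-odd *≋ t-odd
    ; x≋0 = ≋-trans (double-x-≋ x≋0 z²≋1) (congruent (+ 3) refl)
    ; z²≋1 = ≋-trans (≋-reflexive z′²≡4w²) (≋-trans (≋-refl {a = + 4} *≋ (w≋1 *≋ w≋1)) (congruent 1ℤ refl))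
    -- At x = 0, z² = 1 the new y is 35, and the new z is 2w ≡ 2; their product is 70 = 1 + 23 · 3.
    ; w≋1 = ≋-trans (≋-reflexive (cong (double-y x Z *_) z′≡2w))
        (≋-trans (double-y-≋ x≋0 z²≋1 *≋ (≋-refl {a = + 2} *≋ w≋1)) (congruent (+ 23) refl))
    }
    where
    open CurvePoint P
    Z = z * z
    Z-even : Z ≋ 0ℤ [mod + 2 ]
    Z-even = z-even *≋ z-even

    double-x-≋ : ∀ {m x′ z′} → x ≋ x′ [mod m ] → Z ≋ z′ [mod m ] →
      double-x x Z ≋ double-x x′ z′ [mod m ]
    double-x-≋ x≋ z≋ = x≋ *≋ x≋ *≋ x≋ *≋ x≋ -≋ ≋-refl {a = + 6} *≋ x≋ *≋ x≋ *≋ z≋ *≋ z≋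
        -≋ ≋-refl {a = + 8} *≋ x≋ *≋ z≋ *≋ z≋ *≋ z≋ +≋ ≋-refl {a = + 9} *≋ z≋ *≋ z≋ *≋ z≋ *≋ z≋

    double-y-≋ : ∀ {m x′ z′} → x ≋ x′ [mod m ] → Z ≋ z′ [mod m ] →
      double-y x Z ≋ double-y x′ z′ [mod m ]
    double-y-≋ x≋ z≋ = ≋-refl {a = + 35} *≋ z≋ *≋ z≋ *≋ z≋ *≋ z≋ *≋ z≋ *≋ z≋
      +≋ ≋-refl {a = + 12} *≋ x≋ *≋ z≋ *≋ z≋ *≋ z≋ *≋ z≋ *≋ z≋
      +≋ ≋-refl {a = + 45} *≋ x≋ *≋ x≋ *≋ z≋ *≋ z≋ *≋ z≋ *≋ z≋
      -≋ ≋-refl {a = + 20} *≋ x≋ *≋ x≋ *≋ x≋ *≋ z≋ *≋ z≋ *≋ z≋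
      -≋ ≋-refl {a = + 15} *≋ x≋ *≋ x≋ *≋ x≋ *≋ x≋ *≋ z≋ *≋ z≋
      -≋ x≋ *≋ x≋ *≋ x≋ *≋ x≋ *≋ x≋ *≋ x≋

    -- The new denominator 2yz: as y is odd, its valuation exceeds that of z by exactly one.
    z′ : ℤ
    z′ = (+ 2) ^ suc (suc n) * (y * t)

    z′≡2w : z′ ≡ + 2 * w
    z′≡2w = identity ((+ 2) ^ suc n) y t
      where
      identity : ∀ p y t → + 2 * p * (y * t) ≡ + 2 * (y * (p * t))
      identity = solve-∀

    z′²≡4w² : z′ * z′ ≡ + 4 * (w * w)
    z′²≡4w² = trans (cong (λ z → z * z) z′≡2w) (identity w)
      where
      identity : ∀ w → + 2 * w * (+ 2 * w) ≡ + 4 * (w * w)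
      identity = solve-∀

    z′² : z′ * z′ ≡ + 4 * weierstrass x Z * Z
    z′² = trans z′²≡4w² (trans (identity y z) (cong (λ v → + 4 * v * Z) on-curve))
      where
      identity : ∀ y z → + 4 * (y * z * (y * z)) ≡ + 4 * (y * y) * (z * z)
      identity = solve-∀

  curvePoint : ∀ n → CurvePoint n
  curvePoint zero    = initial
  curvePoint (suc n) = double (curvePoint n)

  -- The arguments are x, z² and w = yz.  Normalising the rational root a to z² − x and the sum s
  -- of the roots of the quadratic factor to z² + x, the equation h₄ = 0 becomes quadratic in the
  -- product p of these roots; its discriminant is a square precisely on the curve.  The cubic
  -- factor is x³ + h₁x² + h₂x + h₃ for the complete homogeneous hᵢ in the other three roots.
  rationalRoot rootSum rootProduct cubic₀ cubic₁ cubic₂ : ℤ → ℤ → ℤ → ℤ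
  rationalRoot x z w = z - x
  rootSum x z w = z + x
  rootProduct x z w = + 3 * z * z + + 2 * x * z + x * x + + 2 * w
  cubic₂ x z w = + 2 * z
  cubic₁ x z w = - (+ 2 * (x * z + w))
  cubic₀ x z w = - (+ 5 * z * z * z + + 9 * x * z * z + x * x * z + x * x * x + + 6 * w * z + + 2 * w * x)

  linear quadratic cubic : ℤ → ℤ → ℤ → List ℤ
  linear    x z w = - rationalRoot x z w ∷ 1ℤ ∷ []
  quadratic x z w = rootProduct x z w ∷ - rootSum x z w ∷ 1ℤ ∷ []
  cubic     x z w = cubic₀ x z w ∷ cubic₁ x z w ∷ cubic₂ x z w ∷ 1ℤ ∷ []

  -- Coefficients of the product of the three factors.

  productCoeff : ℤ → ℤ → ℤ → ℕ → ℤ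
  productCoeff x z w = convolve (linear x z w) (convolve (quadratic x z w) (coeffℤ (cubic x z w)))

  -- Definitions are opaque to solve-∀, whence the repeated let-bindings.
  productCoeff-5 : ∀ x z w →
    let a = z - x ; s = z + x ; c₂ = + 2 * z
        p = + 3 * z * z + + 2 * x * z + x * x + + 2 * w
        R₄ = p * 0ℤ + (- s * 1ℤ + (1ℤ * c₂ + 0ℤ))
        R₅ = p * 0ℤ + (- s * 0ℤ + (1ℤ * 1ℤ + 0ℤ))
    in - a * R₅ + (1ℤ * R₄ + 0ℤ) ≡ 0ℤ
  productCoeff-5 = solve-∀

  productCoeff-4 : ∀ x z w →
    let a = z - x ; s = z + x ; c₂ = + 2 * z ; c₁ = - (+ 2 * (x * z + w))
        p = + 3 * z * z + + 2 * x * z + x * x + + 2 * w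
        R₃ = p * 1ℤ + (- s * c₂ + (1ℤ * c₁ + 0ℤ))
        R₄ = p * 0ℤ + (- s * 1ℤ + (1ℤ * c₂ + 0ℤ))
    in - a * R₄ + (1ℤ * R₃ + 0ℤ) ≡ 0ℤ
  productCoeff-4 = solve-∀

  productCoeff-3 : ∀ x z w →
    let a = z - x ; s = z + x ; c₂ = + 2 * z ; c₁ = - (+ 2 * (x * z + w))
        p = + 3 * z * z + + 2 * x * z + x * x + + 2 * w
        c₀ = - (+ 5 * z * z * z + + 9 * x * z * z + x * x * z + x * x * x + + 6 * w * z + + 2 * w * x)
        R₂ = p * c₂ + (- s * c₁ + (1ℤ * c₀))
        R₃ = p * 1ℤ + (- s * c₂ + (1ℤ * c₁ + 0ℤ))
    in - a * R₃ + (1ℤ * R₂ + 0ℤ) ≡ 0ℤ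
  productCoeff-3 = solve-∀

  -- Coefficients 3, 4 and 5 vanish identically; this one needs the curve. For z = ζ² and w = yζ the
  -- right side is 4ζ² times the defect of the curve equation.
  productCoeff-2-residual : ∀ x z w →
    let a = z - x ; s = z + x ; c₂ = + 2 * z ; c₁ = - (+ 2 * (x * z + w))
        p = + 3 * z * z + + 2 * x * z + x * x + + 2 * w
        c₀ = - (+ 5 * z * z * z + + 9 * x * z * z + x * x * z + x * x * x + + 6 * w * z + + 2 * w * x)
        R₁ = p * c₁ + - s * c₀
        R₂ = p * c₂ + (- s * c₁ + 1ℤ * c₀)
    in - a * R₂ + (1ℤ * R₁ + 0ℤ) ≡ + 4 * (z * (x * x * x + + 3 * x * z * z + z * z * z) - w * w)
  productCoeff-2-residual = solve-∀

  -- Substituting z = ζ² and w = yζ exposes the factor 4ζ, which carries the whole 2-adic valuation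
  -- of A when x and y are odd and ζ is even.
  productCoeff-1-factors : ∀ x y ζ →
    let z = ζ * ζ ; w = y * ζ
        a = z - x ; s = z + x ; c₁ = - (+ 2 * (x * z + w))
        p = + 3 * z * z + + 2 * x * z + x * x + + 2 * w
        c₀ = - (+ 5 * z * z * z + + 9 * x * z * z + x * x * z + x * x * x + + 6 * w * z + + 2 * w * x)
        R₀ = p * c₀
        R₁ = p * c₁ + - s * c₀
        k  = x * x * x + x * x * z + + 5 * x * z * z + z * z * z + + 2 * w * (x + z)
    in - a * R₁ + 1ℤ * R₀ ≡ + 4 * ζ * (ζ * ζ * ζ * c₀ - (x * ζ + y) * k)
  productCoeff-1-factors = solve-∀

  productCoeff-above-zero : ∀ p s a →
    - a * (p * 0ℤ + (- s * 0ℤ + (1ℤ * 0ℤ + 0ℤ))) +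
    (1ℤ * (p * 0ℤ + (- s * 0ℤ + (1ℤ * 0ℤ + 0ℤ))) + 0ℤ) ≡ 0ℤ
  productCoeff-above-zero = solve-∀

  productCoeff-6 : ∀ p s a →
    - a * (p * 0ℤ + (- s * 0ℤ + (1ℤ * 0ℤ + 0ℤ))) +
    (1ℤ * (p * 0ℤ + (- s * 0ℤ + (1ℤ * 1ℤ + 0ℤ))) + 0ℤ) ≡ 1ℤ
  productCoeff-6 = solve-∀

  -- Binary forms modulo 3.

  quadraticForm : ℤ → ℤ → ℤ → ℤ → ℤ
  quadraticForm q₀ q₁ n d = n * n + q₁ * n * d + q₀ * d * d

  cubicForm : ℤ → ℤ → ℤ → ℤ → ℤ → ℤ
  cubicForm c₀ c₁ c₂ n d = n * n * n + c₂ * n * n * d + c₁ * n * d * d + c₀ * d * d * d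

  homogenise-quadratic : ∀ q₀ q₁ n d →
    q₀ * (d * (d * (d * 1ℤ))) + n * (q₁ * (d * (d * 1ℤ)) + n * (1ℤ * (d * 1ℤ) + n * 0ℤ))
      ≡ d * (n * n + q₁ * n * d + q₀ * d * d)
  homogenise-quadratic = solve-∀

  homogenise-cubic : ∀ c₀ c₁ c₂ n d →
    c₀ * (d * (d * (d * (d * 1ℤ)))) + n * (c₁ * (d * (d * (d * 1ℤ)))
    + n * (c₂ * (d * (d * 1ℤ)) + n * (1ℤ * (d * 1ℤ) + n * 0ℤ)))
      ≡ d * (n * n * n + c₂ * n * n * d + c₁ * n * d * d + c₀ * d * d * d)
  homogenise-cubic = solve-∀

  quadraticForm-≋ : ∀ {m q₀ q₁ n d q₀′ q₁′ n′ d′} → q₀ ≋ q₀′ [mod m ] → q₁ ≋ q₁′ [mod m ] →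
    n ≋ n′ [mod m ] → d ≋ d′ [mod m ] → quadraticForm q₀ q₁ n d ≋ quadraticForm q₀′ q₁′ n′ d′ [mod m ]
  quadraticForm-≋ q₀≋ q₁≋ n≋ d≋ = n≋ *≋ n≋ +≋ q₁≋ *≋ n≋ *≋ d≋ +≋ q₀≋ *≋ d≋ *≋ d≋

  cubicForm-≋ : ∀ {m c₀ c₁ c₂ n d c₀′ c₁′ c₂′ n′ d′} →
    c₀ ≋ c₀′ [mod m ] → c₁ ≋ c₁′ [mod m ] → c₂ ≋ c₂′ [mod m ] →
    n ≋ n′ [mod m ] → d ≋ d′ [mod m ] → cubicForm c₀ c₁ c₂ n d ≋ cubicForm c₀′ c₁′ c₂′ n′ d′ [mod m ]
  cubicForm-≋ c₀≋ c₁≋ c₂≋ n≋ d≋ =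
    n≋ *≋ n≋ *≋ n≋ +≋ c₂≋ *≋ n≋ *≋ n≋ *≋ d≋ +≋ c₁≋ *≋ n≋ *≋ d≋ *≋ d≋ +≋ c₀≋ *≋ d≋ *≋ d≋ *≋ d≋

  -- The constants 5 and -1 are `rootProduct` and `- rootSum` at x = 0, z² = w = 1, the residues
  -- shared by all points. The nine pairs are checked by evaluation.
  anisotropic-quadratic : ∀ (i j : Fin 3) →
    3 ℕ.∣ ∣ quadraticForm (+ 5) -1ℤ (+ toℕ i) (+ toℕ j) ∣ → toℕ i ≡ 0 × toℕ j ≡ 0
  anisotropic-quadratic = from-yes (Fin.all? {3} λ i → Fin.all? {3} λ j →
    (3 ℕ.∣? ∣ quadraticForm (+ 5) -1ℤ (+ toℕ i) (+ toℕ j) ∣) →-dec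
    ((toℕ i ℕ.≟ 0) ×-dec (toℕ j ℕ.≟ 0)))

  -- The constants are `cubic₀`, `cubic₁` and `cubic₂` at the same residues.
  anisotropic-cubic : ∀ (i j : Fin 3) →
    3 ℕ.∣ ∣ cubicForm (- + 11) (- + 2) (+ 2) (+ toℕ i) (+ toℕ j) ∣ → toℕ i ≡ 0 × toℕ j ≡ 0
  anisotropic-cubic = from-yes (Fin.all? {3} λ i → Fin.all? {3} λ j →
    (3 ℕ.∣? ∣ cubicForm (- + 11) (- + 2) (+ 2) (+ toℕ i) (+ toℕ j) ∣) →-dec
    ((toℕ i ℕ.≟ 0) ×-dec (toℕ j ℕ.≟ 0)))

  -- 2-adic valuations.

  -- The valuation as a relation rather than a function; no exponent is related to zero.
  record ExactPower (k : ℕ) (a : ℤ) : Set where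
    constructor exactPower
    field
      {cofactor}   : ℤ
      cofactor-odd : Odd cofactor
      equality     : a ≡ (+ 2) ^ k * cofactor

  ¬odd[2*] : ∀ {a} → ¬ Odd (+ 2 * a)
  ¬odd[2*] {a} odd = contradiction (≋0⇒∣ (≋-trans (≋-sym odd) (2*≋0 a))) (from-no (2 ℕ.∣? 1))

  exactPower-* : ∀ {k l a b} → ExactPower k a → ExactPower l b → ExactPower (k ℕ.+ l) (a * b)
  exactPower-* {k} {l} (exactPower {u} u-odd refl) (exactPower {v} v-odd refl) =
    exactPower (u-odd *≋ v-odd) (trans (identity ((+ 2) ^ k) u ((+ 2) ^ l) v)
      (cong (_* (u * v)) (sym (^-distribˡ-+-* (+ 2) k l))))
    where
    identity : ∀ p u q v → p * u * (q * v) ≡ p * q * (u * v)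
    identity = solve-∀

  exactPower-^ : ∀ {k a} n → ExactPower k a → ExactPower (n ℕ.* k) (a ^ n)
  exactPower-^ zero    _ = exactPower ≋-refl refl
  exactPower-^ (suc n) e = exactPower-* e (exactPower-^ n e)

  -- Common factors 2 are cancelled until one exponent is zero; parity then decides.
  exactPower-unique : ∀ {k l a} → ExactPower k a → ExactPower l a → k ≡ l
  exactPower-unique {k} {l} (exactPower {u} u-odd a≡2ᵏu) (exactPower {v} v-odd a≡2ˡv) =
    unique k l (trans (sym a≡2ᵏu) a≡2ˡv)
    where
    unique : ∀ k l → (+ 2) ^ k * u ≡ (+ 2) ^ l * v → k ≡ l
    unique zero    zero    _  = refl
    unique zero    (suc l) eq = contradiction
      (subst Odd (trans (sym (*-identityˡ u)) (trans eq (*-assoc (+ 2) ((+ 2) ^ l) v))) u-odd) ¬odd[2*]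
    unique (suc k) zero    eq = contradiction
      (subst Odd (trans (sym (*-identityˡ v)) (trans (sym eq) (*-assoc (+ 2) ((+ 2) ^ k) u))) v-odd) ¬odd[2*]
    unique (suc k) (suc l) eq = cong suc (unique k l (*-cancelˡ-≡ (+ 2) _ _
      (trans (sym (*-assoc (+ 2) ((+ 2) ^ k) u)) (trans eq (*-assoc (+ 2) ((+ 2) ^ l) v)))))

  exactPower-≢0 : ∀ {k a} → ExactPower k a → a ≢ 0ℤ
  exactPower-≢0 {k} {a} (exactPower {u} u-odd a≡2ᵏu) a≡0 =
    ¬odd[2*] {0ℤ} (subst Odd (vanishes k (trans (sym a≡2ᵏu) a≡0)) u-odd)
    where
    vanishes : ∀ k → (+ 2) ^ k * u ≡ 0ℤ → u ≡ + 2 * 0ℤ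
    vanishes zero    eq = trans (sym (*-identityˡ u)) eq
    vanishes (suc k) eq = vanishes k (*-cancelˡ-≡ (+ 2) _ 0ℤ (trans (sym (*-assoc (+ 2) ((+ 2) ^ k) u)) eq))

  -- The trinomial attached to a curve point.

  module _ {n} (P : CurvePoint n) where
    open CurvePoint P

    private
      Z : ℤ
      Z = z * z

      Z-even : Z ≋ 0ℤ [mod + 2 ]
      Z-even = z-even *≋ z-even

    familyB familyA : ℤ
    familyB = productCoeff x Z w 0
    familyA = productCoeff x Z w 1

    rootProduct-≋ : ∀ {m x′ z′ w′} → x ≋ x′ [mod m ] → Z ≋ z′ [mod m ] → w ≋ w′ [mod m ] →
      rootProduct x Z w ≋ rootProduct x′ z′ w′ [mod m ]
    rootProduct-≋ x≋ z≋ w≋ =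
      ≋-refl {a = + 3} *≋ z≋ *≋ z≋ +≋ ≋-refl {a = + 2} *≋ x≋ *≋ z≋ +≋ x≋ *≋ x≋ +≋ ≋-refl {a = + 2} *≋ w≋

    cubic₁-≋ : ∀ {m x′ z′ w′} → x ≋ x′ [mod m ] → Z ≋ z′ [mod m ] → w ≋ w′ [mod m ] →
      cubic₁ x Z w ≋ cubic₁ x′ z′ w′ [mod m ]
    cubic₁-≋ x≋ z≋ w≋ = -≋ (≋-refl {a = + 2} *≋ (x≋ *≋ z≋ +≋ w≋))

    cubic₀-≋ : ∀ {m x′ z′ w′} → x ≋ x′ [mod m ] → Z ≋ z′ [mod m ] → w ≋ w′ [mod m ] →
      cubic₀ x Z w ≋ cubic₀ x′ z′ w′ [mod m ]
    cubic₀-≋ x≋ z≋ w≋ = -≋ (≋-refl {a = + 5} *≋ z≋ *≋ z≋ *≋ z≋ +≋ ≋-refl {a = + 9} *≋ x≋ *≋ z≋ *≋ z≋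
      +≋ x≋ *≋ x≋ *≋ z≋ +≋ x≋ *≋ x≋ *≋ x≋ +≋ ≋-refl {a = + 6} *≋ w≋ *≋ z≋ +≋ ≋-refl {a = + 2} *≋ w≋ *≋ x≋)

    quadratic-mod-3 : ∀ {n d n′ d′} → n ≋ n′ [mod + 3 ] → d ≋ d′ [mod + 3 ] →
      quadraticForm (rootProduct x Z w) (- rootSum x Z w) n d ≋
      quadraticForm (+ 5) -1ℤ n′ d′ [mod + 3 ]
    quadratic-mod-3 = quadraticForm-≋ (rootProduct-≋ x≋0 z²≋1 w≋1) (-≋ (z²≋1 +≋ x≋0))

    cubic-mod-3 : ∀ {n d n′ d′} → n ≋ n′ [mod + 3 ] → d ≋ d′ [mod + 3 ] →
      cubicForm (cubic₀ x Z w) (cubic₁ x Z w) (cubic₂ x Z w) n d ≋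
      cubicForm (- + 11) (- + 2) (+ 2) n′ d′ [mod + 3 ]
    cubic-mod-3 = cubicForm-≋ (cubic₀-≋ x≋0 z²≋1 w≋1) (cubic₁-≋ x≋0 z²≋1 w≋1) (≋-refl {a = + 2} *≋ z²≋1)

    -- B is the product of the three constant terms. Modulo 2 the point has x = 1 and z² = w = 0,
    -- where these are 1, 1 and -1.
    familyB-odd : ExactPower 0 familyB
    familyB-odd = exactPower odd (sym (*-identityˡ familyB))
      where
      w-even : w ≋ 0ℤ [mod + 2 ]
      w-even = y-odd *≋ z-even
      odd : Odd familyB
      odd = ≋-trans
        (-≋ (Z-even -≋ x-odd) *≋ (rootProduct-≋ x-odd Z-even w-even *≋ cubic₀-≋ x-odd Z-even w-even))
        (congruent -1ℤ refl)

    -- A is 4z times κ: the factor 4 contributes 2 and z contributes n + 1. Modulo 2, κ reduces to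
    -- -yk with y and k odd.
    familyA-exactPower : ExactPower (3 ℕ.+ n) familyA
    familyA-exactPower = exactPower (t-odd *≋ κ-odd)
      (trans (productCoeff-1-factors x y z) (identity ((+ 2) ^ n) t κ))
      where
      k κ : ℤ
      k = x * x * x + x * x * Z + + 5 * x * Z * Z + Z * Z * Z + + 2 * w * (x + Z)
      κ = z * z * z * cubic₀ x Z w - (x * z + y) * k
      k-odd : Odd k
      k-odd =
        x-odd *≋ x-odd *≋ x-odd +≋ x-odd *≋ x-odd *≋ Z-even +≋ ≋-refl {a = + 5} *≋ x-odd *≋ Z-even *≋ Z-even
        +≋ Z-even *≋ Z-even *≋ Z-even +≋ ≋-refl {a = + 2} *≋ (y-odd *≋ z-even) *≋ (x-odd +≋ Z-even)
      κ-odd : Odd κ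
      κ-odd = ≋-trans
        (z-even *≋ z-even *≋ z-even *≋ ≋-refl {a = cubic₀ x Z w} -≋ (x-odd *≋ z-even +≋ y-odd) *≋ k-odd)
        (congruent -1ℤ refl)
      identity : ∀ q t κ → + 4 * (+ 2 * q * t) * κ ≡ + 2 * (+ 2 * (+ 2 * q)) * (t * κ)
      identity = solve-∀

    productCoeff-2 : productCoeff x Z w 2 ≡ 0ℤ
    productCoeff-2 = trans (productCoeff-2-residual x Z w)
      (trans (cong (λ v → + 4 * (Z * v - w * w)) (sym on-curve)) (identity y z))
      where
      identity : ∀ y z → + 4 * (z * z * (y * y) - y * z * (y * z)) ≡ 0ℤ
      identity = solve-∀

    productCoeff-above : ∀ k → productCoeff x Z w (7 ℕ.+ k) ≡ 0ℤ
    productCoeff-above k = productCoeff-above-zero (rootProduct x Z w) (rootSum x Z w) (rationalRoot x Z w)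

open Integers
open import Algebra.Definitions.RawMagma using () renaming (_,_ to _,∣_)
import Algebra.Definitions.RawSemiring as RawSemiringDefinitions
open import Data.Integer.Base as ℤ using (ℤ; +_; 0ℤ; 1ℤ)
import Data.Integer.Properties as ℤ
open import Data.List.Relation.Binary.Pointwise.Base using ([]; _∷_)
open import Data.List.Relation.Unary.All using ([]; _∷_)
open import Data.List.Relation.Unary.Linked using ([-]; _∷_)
import Data.Nat.Coprimality as Coprimality
open import Data.Rational.Base hiding (∣_∣)
open import Data.Rational.Properties
import Data.Rational.Unnormalised.Base as ℚᵘ
import Data.Rational.Unnormalised.Properties as ℚᵘ
open import Level using (0ℓ)
open import Relation.Binary.Definitions using (tri<; tri≈; tri>)
open import Relation.Nullary.Decidable.Core using (dec⇒maybe)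
open import Tactic.RingSolver using (solve-∀)
open import Tactic.RingSolver.Core.AlmostCommutativeRing
  using (AlmostCommutativeRing; fromCommutativeRing)
open RawSemiringDefinitions polyRawSemiring using (_∣_; mkIrred)
open RawSemiringDefinitions +-*-rawSemiring using () renaming (_^_ to _^ℚ_)

-- Arithmetic of the rational field.

ℚ-ring : AlmostCommutativeRing 0ℓ 0ℓ
ℚ-ring = fromCommutativeRing +-*-commutativeRing (λ p → dec⇒maybe (0ℚ ≟ p))

p*q≡0⇒p≡0∨q≡0 : ∀ p {q} → p * q ≡ 0ℚ → p ≡ 0ℚ ⊎ q ≡ 0ℚ
p*q≡0⇒p≡0∨q≡0 p {q} pq≡0 with p ≟ 0ℚ
... | yes p≡0 = inj₁ p≡0
... | no  p≢0 = inj₂ (begin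
  q                ≡⟨ sym (*-identityˡ q) ⟩
  1ℚ * q           ≡⟨ cong (_* q) (sym (*-inverseˡ p)) ⟩
  1/ p * p * q     ≡⟨ *-assoc (1/ p) p q ⟩
  1/ p * (p * q)   ≡⟨ cong (1/ p *_) pq≡0 ⟩
  1/ p * 0ℚ        ≡⟨ *-zeroʳ (1/ p) ⟩
  0ℚ               ∎)
  where
  open ≡-Reasoning
  instance
    nz : NonZero p
    nz = ≢-nonZero p≢0

*-≢0 : ∀ {p q} → p ≢ 0ℚ → q ≢ 0ℚ → p * q ≢ 0ℚ
*-≢0 {p} p≢0 q≢0 pq≡0 with p*q≡0⇒p≡0∨q≡0 p pq≡0
... | inj₁ p≡0 = p≢0 p≡0
... | inj₂ q≡0 = q≢0 q≡0

-- Serves to write u + vx as v(x - r).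
linear-root : ∀ u v → v ≢ 0ℚ → ∃[ r ] u ≡ - (v * r)
linear-root u v v≢0 = - (1/ v * u) , (begin
  u                     ≡⟨ sym (*-identityˡ u) ⟩
  1ℚ * u                ≡⟨ cong (_* u) (sym (*-inverseʳ v)) ⟩
  v * 1/ v * u          ≡⟨ rearrange v (1/ v) u ⟩
  - (v * - (1/ v * u))  ∎)
  where
  open ≡-Reasoning
  instance
    nz : NonZero v
    nz = ≢-nonZero v≢0
  rearrange : ∀ v i u → v * i * u ≡ - (v * - (i * u))
  rearrange = solve-∀ ℚ-ring

-- Coefficients and degrees of rational polynomials.

coeff-+ₚ : ∀ p q k → coeff (p +ₚ q) k ≡ coeff p k + coeff q k
coeff-+ₚ []      q       k       = sym (+-identityˡ _)
coeff-+ₚ (a ∷ p) []      k       = sym (+-identityʳ _)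
coeff-+ₚ (a ∷ p) (b ∷ q) zero    = refl
coeff-+ₚ (a ∷ p) (b ∷ q) (suc k) = coeff-+ₚ p q k

coeff-map-* : ∀ a p k → coeff (map (a *_) p) k ≡ a * coeff p k
coeff-map-* a []      k       = sym (*-zeroʳ a)
coeff-map-* a (b ∷ p) zero    = refl
coeff-map-* a (b ∷ p) (suc k) = coeff-map-* a p k

coeff-*ₚ-zero : ∀ a p q → coeff ((a ∷ p) *ₚ q) 0 ≡ a * coeff q 0
coeff-*ₚ-zero a p q = begin
  coeff ((a ∷ p) *ₚ q) 0              ≡⟨ coeff-+ₚ (map (a *_) q) (0ℚ ∷ (p *ₚ q)) 0 ⟩
  coeff (map (a *_) q) 0 + 0ℚ         ≡⟨ +-identityʳ _ ⟩
  coeff (map (a *_) q) 0              ≡⟨ coeff-map-* a q 0 ⟩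
  a * coeff q 0                       ∎
  where open ≡-Reasoning

coeff-*ₚ-suc : ∀ a p q k →
  coeff ((a ∷ p) *ₚ q) (suc k) ≡ a * coeff q (suc k) + coeff (p *ₚ q) k
coeff-*ₚ-suc a p q k = trans
  (coeff-+ₚ (map (a *_) q) (0ℚ ∷ (p *ₚ q)) (suc k))
  (cong (_+ coeff (p *ₚ q) k) (coeff-map-* a q (suc k)))

*ₚ-zeroˡ : ∀ p q → p ≈ₚ [] → p *ₚ q ≈ₚ []
*ₚ-zeroˡ []      q p≈0 k       = refl
*ₚ-zeroˡ (a ∷ p) q p≈0 zero    =
  trans (coeff-*ₚ-zero a p q) (trans (cong (_* coeff q 0) (p≈0 0)) (*-zeroˡ (coeff q 0)))
*ₚ-zeroˡ (a ∷ p) q p≈0 (suc k) = begin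
  coeff ((a ∷ p) *ₚ q) (suc k)                  ≡⟨ coeff-*ₚ-suc a p q k ⟩
  a * coeff q (suc k) + coeff (p *ₚ q) k
    ≡⟨ cong₂ (λ b c → b * coeff q (suc k) + c) (p≈0 0) (*ₚ-zeroˡ p q (p≈0 ∘ suc) k) ⟩
  0ℚ * coeff q (suc k) + 0ℚ                     ≡⟨ +-identityʳ _ ⟩
  0ℚ * coeff q (suc k)                          ≡⟨ *-zeroˡ (coeff q (suc k)) ⟩
  0ℚ                                            ∎
  where open ≡-Reasoning

*ₚ-zeroʳ : ∀ p q → q ≈ₚ [] → p *ₚ q ≈ₚ []
*ₚ-zeroʳ []      q q≈0 k       = refl
*ₚ-zeroʳ (a ∷ p) q q≈0 zero    =
  trans (coeff-*ₚ-zero a p q) (trans (cong (a *_) (q≈0 0)) (*-zeroʳ a))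
*ₚ-zeroʳ (a ∷ p) q q≈0 (suc k) = begin
  coeff ((a ∷ p) *ₚ q) (suc k)                  ≡⟨ coeff-*ₚ-suc a p q k ⟩
  a * coeff q (suc k) + coeff (p *ₚ q) k
    ≡⟨ cong₂ (λ b c → a * b + c) (q≈0 (suc k)) (*ₚ-zeroʳ p q q≈0 k) ⟩
  a * 0ℚ + 0ℚ                                   ≡⟨ +-identityʳ _ ⟩
  a * 0ℚ                                        ≡⟨ *-zeroʳ a ⟩
  0ℚ                                            ∎
  where open ≡-Reasoning

*ₚ-identityʳ : ∀ p → p *ₚ const 1ℚ ≈ₚ p
*ₚ-identityʳ []      k       = refl
*ₚ-identityʳ (a ∷ p) zero    = trans (coeff-*ₚ-zero a p (const 1ℚ)) (*-identityʳ a)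
*ₚ-identityʳ (a ∷ p) (suc k) = trans (coeff-*ₚ-suc a p (const 1ℚ) k)
  (trans (cong₂ _+_ (*-zeroʳ a) (*ₚ-identityʳ p k)) (+-identityˡ _))

-- Leading coefficients multiply to a nonzero number. Trailing zeros are allowed, so the case split
-- is on the degree of the left factor: in degree 0 its tail vanishes and it acts as a scalar,
-- otherwise its head does not reach the leading term.
degree-* : ∀ p q {m n} → HasDegree p m → HasDegree q n → HasDegree (p *ₚ q) (m ℕ.+ n)
degree-* []      q         (0≢0 , _)      _               = contradiction refl 0≢0
degree-* (a ∷ p) q {zero}  {n} (a≢0 , p≈0) (q≢0 , q≈0)    =
  (λ lead≡0 → *-≢0 a≢0 q≢0 (trans (sym (scalar n)) lead≡0)) ,
  (λ {k} n<k → trans (scalar k) (trans (cong (a *_) (q≈0 n<k)) (*-zeroʳ a)))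
  where
  scalar : ∀ k → coeff ((a ∷ p) *ₚ q) k ≡ a * coeff q k
  scalar zero    = coeff-*ₚ-zero a p q
  scalar (suc k) = trans (coeff-*ₚ-suc a p q k)
    (trans (cong (λ c → a * coeff q (suc k) + c) (*ₚ-zeroˡ p q (λ j → p≈0 (s≤s z≤n)) k)) (+-identityʳ _))
degree-* (a ∷ p) q {suc m} {n} (p≢0 , p≈0) dq@(q≢0 , q≈0) =
  (λ lead≡0 → proj₁ ih (trans (sym (shift (m ℕ.+ n) (s≤s (ℕ.m≤n+m n m)))) lead≡0)) ,
  λ { {suc k} (s≤s m+n<k) → trans
    (shift k (s≤s (ℕ.≤-trans (ℕ.m≤n+m n m) (ℕ.<⇒≤ m+n<k))))
    (proj₂ ih m+n<k) }
  where
  ih : HasDegree (p *ₚ q) (m ℕ.+ n)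
  ih = degree-* p q (p≢0 , λ m<k → p≈0 (s≤s m<k)) dq
  shift : ∀ k → n ℕ.< suc k → coeff ((a ∷ p) *ₚ q) (suc k) ≡ coeff (p *ₚ q) k
  shift k n<1+k = trans (coeff-*ₚ-suc a p q k)
    (trans (cong (_+ coeff (p *ₚ q) k) (trans (cong (a *_) (q≈0 n<1+k)) (*-zeroʳ a))) (+-identityˡ _))

degree-≈ₚ : ∀ p q {n} → p ≈ₚ q → HasDegree p n → HasDegree q n
degree-≈ₚ p q p≈q (p≢0 , p≈0) =
  (λ q≡0 → p≢0 (trans (p≈q _) q≡0)) , λ n<k → trans (sym (p≈q _)) (p≈0 n<k)

degree-unique : ∀ p {m n} → HasDegree p m → HasDegree p n → m ≡ n
degree-unique p {m} {n} (pm≢0 , p>m) (pn≢0 , p>n) with ℕ.<-cmp m n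
... | tri< m<n _ _ = contradiction (p>m m<n) pn≢0
... | tri≈ _ m≡n _ = m≡n
... | tri> _ _ n<m = contradiction (p>n n<m) pm≢0

degree? : ∀ p → p ≈ₚ [] ⊎ ∃[ n ] HasDegree p n
degree? []      = inj₁ (λ k → refl)
degree? (a ∷ p) with degree? p
... | inj₂ (n , p≢0 , p≈0) = inj₂ (suc n , p≢0 , λ { {suc k} (s≤s n<k) → p≈0 n<k })
... | inj₁ p≈0 with a ≟ 0ℚ
...   | yes a≡0 = inj₁ λ { zero → a≡0 ; (suc k) → p≈0 k }
...   | no  a≢0 = inj₂ (0 , a≢0 , λ { {suc k} _ → p≈0 k })

-- Evaluation of polynomials.

eval : Poly → ℚ → ℚ
eval []      r = 0ℚ
eval (a ∷ p) r = a + r * eval p r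

eval-zero : ∀ p r → p ≈ₚ [] → eval p r ≡ 0ℚ
eval-zero []      r p≈0 = refl
eval-zero (a ∷ p) r p≈0 =
  trans (cong₂ (λ b c → b + r * c) (p≈0 0) (eval-zero p r (p≈0 ∘ suc))) (trans (+-identityˡ _) (*-zeroʳ r))

eval-≈ₚ : ∀ p q r → p ≈ₚ q → eval p r ≡ eval q r
eval-≈ₚ []      q       r p≈q = sym (eval-zero q r (sym ∘ p≈q))
eval-≈ₚ (a ∷ p) []      r p≈q = eval-zero (a ∷ p) r p≈q
eval-≈ₚ (a ∷ p) (b ∷ q) r p≈q = cong₂ (λ c d → c + r * d) (p≈q 0) (eval-≈ₚ p q r (p≈q ∘ suc))

eval-+ₚ : ∀ p q r → eval (p +ₚ q) r ≡ eval p r + eval q r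
eval-+ₚ []      q       r = sym (+-identityˡ _)
eval-+ₚ (a ∷ p) []      r = sym (+-identityʳ _)
eval-+ₚ (a ∷ p) (b ∷ q) r =
  trans (cong (λ c → a + b + r * c) (eval-+ₚ p q r)) (rearrange a b r (eval p r) (eval q r))
  where
  rearrange : ∀ a b r c d → a + b + r * (c + d) ≡ a + r * c + (b + r * d)
  rearrange = solve-∀ ℚ-ring

eval-map-* : ∀ a p r → eval (map (a *_) p) r ≡ a * eval p r
eval-map-* a []      r = sym (*-zeroʳ a)
eval-map-* a (b ∷ p) r = trans (cong (λ c → a * b + r * c) (eval-map-* a p r)) (rearrange a b r (eval p r))
  where
  rearrange : ∀ a b r c → a * b + r * (a * c) ≡ a * (b + r * c)
  rearrange = solve-∀ ℚ-ring

eval-*ₚ : ∀ p q r → eval (p *ₚ q) r ≡ eval p r * eval q r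
eval-*ₚ []      q r = sym (*-zeroˡ (eval q r))
eval-*ₚ (a ∷ p) q r = begin
  eval (map (a *_) q +ₚ (0ℚ ∷ (p *ₚ q))) r            ≡⟨ eval-+ₚ (map (a *_) q) (0ℚ ∷ (p *ₚ q)) r ⟩
  eval (map (a *_) q) r + (0ℚ + r * eval (p *ₚ q) r)
    ≡⟨ cong₂ (λ b c → b + (0ℚ + r * c)) (eval-map-* a q r) (eval-*ₚ p q r) ⟩
  a * eval q r + (0ℚ + r * (eval p r * eval q r))     ≡⟨ rearrange a r (eval p r) (eval q r) ⟩
  (a + r * eval p r) * eval q r                       ∎
  where
  open ≡-Reasoning
  rearrange : ∀ a r c d → a * d + (0ℚ + r * (c * d)) ≡ (a + r * c) * d
  rearrange = solve-∀ ℚ-ring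

-- Linear factors, units and irreducibility in low degree.

degree-1⇒root : ∀ p → HasDegree p 1 → ∃[ r ] eval p r ≡ 0ℚ
degree-1⇒root []          (0≢0 , _)   = contradiction refl 0≢0
degree-1⇒root (a ∷ [])    (0≢0 , _)   = contradiction refl 0≢0
degree-1⇒root (a ∷ b ∷ p) (b≢0 , p≈0) = map₂ is-root (linear-root a b b≢0)
  where
  cancel : ∀ b r → - (b * r) + r * (b + r * 0ℚ) ≡ 0ℚ
  cancel = solve-∀ ℚ-ring
  is-root : ∀ {r} → a ≡ - (b * r) → eval (a ∷ b ∷ p) r ≡ 0ℚ
  is-root {r} a≡-br = trans
    (cong₂ (λ c d → c + r * (b + r * d)) a≡-br (eval-zero p r λ k → p≈0 (s≤s (s≤s z≤n))))
    (cancel b r)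

degree-0⇒unit : ∀ p → HasDegree p 0 → p ∣ const 1ℚ
degree-0⇒unit p (p₀≢0 , p≈0) = const (1/ coeff p 0) ,∣ divides
  where
  open ≡-Reasoning
  instance
    nz : NonZero (coeff p 0)
    nz = ≢-nonZero p₀≢0
  divides : const (1/ coeff p 0) *ₚ p ≈ₚ const 1ℚ
  divides zero    = trans (coeff-*ₚ-zero (1/ coeff p 0) [] p) (*-inverseˡ (coeff p 0))
  divides (suc k) = begin
    coeff (const (1/ coeff p 0) *ₚ p) (suc k)     ≡⟨ coeff-*ₚ-suc (1/ coeff p 0) [] p k ⟩
    1/ coeff p 0 * coeff p (suc k) + 0ℚ           ≡⟨ +-identityʳ _ ⟩
    1/ coeff p 0 * coeff p (suc k)                ≡⟨ cong (1/ coeff p 0 *_) (p≈0 (s≤s z≤n)) ⟩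
    1/ coeff p 0 * 0ℚ                             ≡⟨ *-zeroʳ (1/ coeff p 0) ⟩
    0ℚ                                            ∎

-- In degree at most 3, a factorisation into nonunits has a linear factor and hence a rational root.
-- The guard `2 ℕ.≤ d` admits degree 1, where a root is present although the polynomial is
-- irreducible.
rootless⇒irreducible : ∀ {p d} → HasDegree p d → 1 ℕ.≤ d → d ℕ.≤ 3 →
  (2 ℕ.≤ d → ∀ r → eval p r ≢ 0ℚ) → Irreducible p
rootless⇒irreducible {p} {d} dp 1≤d d≤3 rootless = mkIrred
  (λ (q ,∣ qp≈1) → not-unit q qp≈1) split
  where
  not-unit : ∀ q → ¬ (q *ₚ p ≈ₚ const 1ℚ)
  not-unit q qp≈1 with degree? q
  ... | inj₁ q≈0 = 1≢0 (trans (sym (qp≈1 0)) (*ₚ-zeroˡ q p q≈0 0))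
  ... | inj₂ (n , dq)
    with degree-unique (const 1ℚ) {n = 0}
           (degree-≈ₚ (q *ₚ p) (const 1ℚ) qp≈1 (degree-* q p dq dp)) (1≢0 , λ { {suc _} _ → refl })
  ...   | n+d≡0 = contradiction (ℕ.≤-trans 1≤d (ℕ.≤-trans (ℕ.m≤n+m d n) (ℕ.≤-reflexive n+d≡0))) λ ()

  root-of-factor : ∀ {q r} → p ≈ₚ q *ₚ r → 2 ℕ.≤ d → ¬ (∃[ t ] (eval q t ≡ 0ℚ ⊎ eval r t ≡ 0ℚ))
  root-of-factor {q} {r} p≈qr 2≤d (t , root) = rootless 2≤d t
    (trans (eval-≈ₚ p (q *ₚ r) t p≈qr) (trans (eval-*ₚ q r t) (vanishes root)))
    where
    vanishes : eval q t ≡ 0ℚ ⊎ eval r t ≡ 0ℚ → eval q t * eval r t ≡ 0ℚ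
    vanishes (inj₁ q≡0) = trans (cong (_* eval r t) q≡0) (*-zeroˡ (eval r t))
    vanishes (inj₂ r≡0) = trans (cong (eval q t *_) r≡0) (*-zeroʳ (eval q t))

  split : ∀ {q r} → p ≈ₚ q *ₚ r → q ∣ const 1ℚ ⊎ r ∣ const 1ℚ
  split {q} {r} p≈qr with degree? q | degree? r
  ... | inj₁ q≈0 | _        = contradiction (trans (p≈qr d) (*ₚ-zeroˡ q r q≈0 d)) (proj₁ dp)
  ... | inj₂ _   | inj₁ r≈0 = contradiction (trans (p≈qr d) (*ₚ-zeroʳ q r r≈0 d)) (proj₁ dp)
  ... | inj₂ (m , dq) | inj₂ (n , dr) =
    cases m n dq dr (degree-unique p dp (degree-≈ₚ (q *ₚ r) p (sym ∘ p≈qr) (degree-* q r dq dr)))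
    where
    cases : ∀ m n → HasDegree q m → HasDegree r n → d ≡ m ℕ.+ n → q ∣ const 1ℚ ⊎ r ∣ const 1ℚ
    cases zero          n             dq dr d≡m+n = inj₁ (degree-0⇒unit q dq)
    cases (suc m)       zero          dq dr d≡m+n = inj₂ (degree-0⇒unit r dr)
    cases (suc zero)    (suc n)       dq dr refl  with t , q≡0 ← degree-1⇒root q dq =
      contradiction (t , inj₁ q≡0) (root-of-factor {q} {r} p≈qr (s≤s (s≤s z≤n)))
    cases (suc (suc m)) (suc zero)    dq dr refl  with t , r≡0 ← degree-1⇒root r dr =
      contradiction (t , inj₂ r≡0) (root-of-factor {q} {r} p≈qr (s≤s (s≤s z≤n)))
    -- Two factors of degree at least 2 would give d ≥ 4.
    cases (suc (suc m)) (suc (suc n)) dq dr refl  =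
      contradiction (ℕ.≤-trans (s≤s (s≤s (ℕ.m≤n+m (2 ℕ.+ n) m))) d≤3) λ { (s≤s (s≤s (s≤s ()))) }

-- The integers inside the rationals.

-- Built with `mkℚ` rather than by normalising a fraction, so that injectivity is that of the
-- constructor.
ι : ℤ → ℚ
ι i = mkℚ i 0 (Coprimality.sym (Coprimality.1-coprimeTo ℤ.∣ i ∣))

ι-injective : ∀ {i j} → ι i ≡ ι j → i ≡ j
ι-injective refl = refl

ι-+ : ∀ i j → ι (i ℤ.+ j) ≡ ι i + ι j
ι-+ i j = sym (trans
  (cong (_/ 1) (cong₂ ℤ._+_ (ℤ.*-identityʳ i) (ℤ.*-identityʳ j)))
  (↥p/↧p≡p (ι (i ℤ.+ j))))

ι-* : ∀ i j → ι (i ℤ.* j) ≡ ι i * ι j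
ι-* i j = sym (↥p/↧p≡p (ι (i ℤ.* j)))

ι-denominator-* : ∀ r → ι (↧ r) * r ≡ ι (↥ r)
ι-denominator-* r@record{} = toℚᵘ-injective (ℚᵘ.≃-trans (toℚᵘ-homo-* (ι (↧ r)) r) (ℚᵘ.*≡* cross))
  where
  cross : ↧ r ℤ.* ↥ r ℤ.* 1ℤ ≡ ↥ r ℤ.* (+ (1 ℕ.* ↧ₙ r))
  cross = begin
    ↧ r ℤ.* ↥ r ℤ.* 1ℤ      ≡⟨ ℤ.*-identityʳ (↧ r ℤ.* ↥ r) ⟩
    ↧ r ℤ.* ↥ r             ≡⟨ ℤ.*-comm (↧ r) (↥ r) ⟩
    ↥ r ℤ.* ↧ r             ≡⟨ cong (λ d → ↥ r ℤ.* (+ d)) (sym (ℕ.*-identityˡ (↧ₙ r))) ⟩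
    ↥ r ℤ.* + (1 ℕ.* ↧ₙ r)  ∎
    where open ≡-Reasoning

-- Trinomials with three linear factors.

trinomialCoeff : ℚ → ℚ → ℕ → ℚ
trinomialCoeff A B 0 = B
trinomialCoeff A B 1 = A
trinomialCoeff A B 6 = 1ℚ
trinomialCoeff A B _ = 0ℚ

coeff-trinomial : ∀ A B k → coeff (trinomial 6 1 (A , B)) k ≡ trinomialCoeff A B k
coeff-trinomial A B 0 = constant-term A B
  where
  constant-term : ∀ A B → 0ℚ + (A * 0ℚ + 0ℚ) + B ≡ B
  constant-term = solve-∀ ℚ-ring
coeff-trinomial A B 1 = linear-term A
  where
  linear-term : ∀ A → 0ℚ + A * 1ℚ ≡ A
  linear-term = solve-∀ ℚ-ring
coeff-trinomial A B 2 = refl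
coeff-trinomial A B 3 = refl
coeff-trinomial A B 4 = refl
coeff-trinomial A B 5 = refl
coeff-trinomial A B 6 = refl
coeff-trinomial A B (suc (suc (suc (suc (suc (suc (suc k))))))) = refl

-- Multiplication by v(x - r) on coefficient sequences. The scalar v is kept because the factors in
-- a reducibility type may have any nonzero leading coefficient.
linearTimes : ℚ → ℚ → (ℕ → ℚ) → ℕ → ℚ
linearTimes v r c zero    = - (v * r) * c 0
linearTimes v r c (suc k) = - (v * r) * c (suc k) + v * c k

linearTimes-cong : ∀ v r {c d} → (∀ k → c k ≡ d k) → ∀ k → linearTimes v r c k ≡ linearTimes v r d k
linearTimes-cong v r c≗d zero    = cong (- (v * r) *_) (c≗d 0)
linearTimes-cong v r c≗d (suc k) = cong₂ (λ x y → - (v * r) * x + v * y) (c≗d (suc k)) (c≗d k)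

coeff-linear-* : ∀ p → HasDegree p 1 →
  ∃[ v ] ∃[ r ] ∀ q k → coeff (p *ₚ q) k ≡ linearTimes v r (coeff q) k
coeff-linear-* []          (0≢0 , _)   = contradiction refl 0≢0
coeff-linear-* (a ∷ [])    (0≢0 , _)   = contradiction refl 0≢0
coeff-linear-* (a ∷ b ∷ p) (b≢0 , p≈0) = b , map₂ product (linear-root a b b≢0)
  where
  product : ∀ {r} → a ≡ - (b * r) → ∀ q k → coeff ((a ∷ b ∷ p) *ₚ q) k ≡ linearTimes b r (coeff q) k
  product a≡-br q zero    = trans (coeff-*ₚ-zero a (b ∷ p) q) (cong (_* coeff q 0) a≡-br)
  product a≡-br q (suc k) = trans (coeff-*ₚ-suc a (b ∷ p) q k)
    (cong₂ (λ x y → x * coeff q (suc k) + y) a≡-br (scalar k))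
    where
    p*q≈0 : p *ₚ q ≈ₚ []
    p*q≈0 = *ₚ-zeroˡ p q λ j → p≈0 (s≤s (s≤s z≤n))
    scalar : ∀ k → coeff ((b ∷ p) *ₚ q) k ≡ b * coeff q k
    scalar zero    = coeff-*ₚ-zero b p q
    scalar (suc k) = trans (coeff-*ₚ-suc b p q k)
      (trans (cong (λ c → b * coeff q (suc k) + c) (p*q≈0 k)) (+-identityʳ _))

0≤p*p : ∀ p → 0ℚ ≤ p * p
0≤p*p p with ≤-total 0ℚ p
... | inj₁ 0≤p =
  nonNegative⁻¹ (p * p) {{nonNeg*nonNeg⇒nonNeg p {{nonNegative 0≤p}} p {{nonNegative 0≤p}}}}
... | inj₂ p≤0 =
  nonNegative⁻¹ (p * p) {{nonPos*nonPos⇒nonPos p {{nonPositive p≤0}} p {{nonPositive p≤0}}}}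

p+q≡0⇒p≡0 : ∀ {p q} → 0ℚ ≤ p → 0ℚ ≤ q → p + q ≡ 0ℚ → p ≡ 0ℚ
p+q≡0⇒p≡0 {p} {q} 0≤p 0≤q p+q≡0 = ≤-antisym
  (≤-trans (≤-reflexive (sym (+-identityʳ p))) (≤-trans (+-monoʳ-≤ p 0≤q) (≤-reflexive p+q≡0)))
  0≤p

p*p≡0⇒p≡0 : ∀ p → p * p ≡ 0ℚ → p ≡ 0ℚ
p*p≡0⇒p≡0 p p*p≡0 = [ id , id ]′ (p*q≡0⇒p≡0∨q≡0 p p*p≡0)

-- Zero by computation beyond index 3, so that the coefficients of the product unfold to the
-- expressions in `vanishing-combination`.
cubicCoeff : ℚ → ℚ → ℚ → ℚ → ℕ → ℚ
cubicCoeff c₀ c₁ c₂ c₃ 0 = c₀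
cubicCoeff c₀ c₁ c₂ c₃ 1 = c₁
cubicCoeff c₀ c₁ c₂ c₃ 2 = c₂
cubicCoeff c₀ c₁ c₂ c₃ 3 = c₃
cubicCoeff c₀ c₁ c₂ c₃ _ = 0ℚ

2h₄ : ℚ → ℚ → ℚ → ℚ
2h₄ a b c = a * a * (a * a) + (b * b * (b * b) + c * c * (c * c)
  + (a * a + b * b + c * c) * ((a + b + c) * (a + b + c)))

-- The bracketing of `2h₄` splits off a⁴ from a nonnegative remainder, so a⁴ vanishes with the sum.
2h₄-definite : ∀ a b c → 2h₄ a b c ≡ 0ℚ → a ≡ 0ℚ
2h₄-definite a b c h≡0 = p*p≡0⇒p≡0 a (p*p≡0⇒p≡0 (a * a) (p+q≡0⇒p≡0
  (0≤p*p (a * a)) (0≤+ (0≤+ (0≤p*p (b * b)) (0≤p*p (c * c))) 0≤last) h≡0))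
  where
  0≤+ : ∀ {p q} → 0ℚ ≤ p → 0ℚ ≤ q → 0ℚ ≤ p + q
  0≤+ {p} {q} 0≤p 0≤q =
    nonNegative⁻¹ (p + q) {{nonNeg+nonNeg⇒nonNeg p {{nonNegative 0≤p}} q {{nonNegative 0≤q}}}}
  0≤* : ∀ {p q} → 0ℚ ≤ p → 0ℚ ≤ q → 0ℚ ≤ p * q
  0≤* {p} {q} 0≤p 0≤q =
    nonNegative⁻¹ (p * q) {{nonNeg*nonNeg⇒nonNeg p {{nonNegative 0≤p}} q {{nonNegative 0≤q}}}}
  0≤last : 0ℚ ≤ (a * a + b * b + c * c) * ((a + b + c) * (a + b + c))
  0≤last = 0≤* (0≤+ (0≤+ (0≤p*p a) (0≤p*p b)) (0≤p*p c)) (0≤p*p (a + b + c))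

-- ∑ⱼ hⱼ(a,b,c) tʲ is the inverse of (1 − at)(1 − bt)(1 − ct), so ∑ⱼ hⱼ f₂₊ⱼ is, up to a constant,
-- the coefficient of x⁻¹ in the cubic cofactor.
vanishing-combination : ∀ a b c u v w c₀ c₁ c₂ c₃ →
  let -ua = - (u * a) ; -vb = - (v * b) ; -wc = - (w * c)
      d₀ = -wc * c₀ ; d₁ = -wc * c₁ + w * c₀ ; d₂ = -wc * c₂ + w * c₁ ; d₃ = -wc * c₃ + w * c₂
      d₄ = -wc * 0ℚ + w * c₃ ; d₅ = -wc * 0ℚ + w * 0ℚ ; d₆ = -wc * 0ℚ + w * 0ℚ
      e₁ = -vb * d₁ + v * d₀ ; e₂ = -vb * d₂ + v * d₁ ; e₃ = -vb * d₃ + v * d₂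
      e₄ = -vb * d₄ + v * d₃ ; e₅ = -vb * d₅ + v * d₄ ; e₆ = -vb * d₆ + v * d₅
      f₂ = -ua * e₂ + u * e₁ ; f₃ = -ua * e₃ + u * e₂ ; f₄ = -ua * e₄ + u * e₃
      f₅ = -ua * e₅ + u * e₄ ; f₆ = -ua * e₆ + u * e₅
      h₁ = a + b + c
      h₂ = a * a + b * b + c * c + a * b + b * c + c * a
      h₃ = a * a * a + b * b * b + c * c * c + a * a * b + a * b * b + b * b * c + b * c * c
           + c * c * a + c * a * a + a * b * c
      twice-h₄ = a * a * (a * a) + (b * b * (b * b) + c * c * (c * c)
           + (a * a + b * b + c * c) * ((a + b + c) * (a + b + c)))
      s = f₂ + h₁ * f₃ + h₂ * f₄ + h₃ * f₅
  in s + s + twice-h₄ * f₆ ≡ 0ℚ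
vanishing-combination = solve-∀ ℚ-ring

-- Definiteness makes the root a zero; B is a multiple of a, so B = 0, against AB ≠ 0.
type-1113-impossible : ∀ A B → A * B ≢ 0ℚ →
  ¬ HasReducibilityType (trinomial 6 1 (A , B)) (1 ∷ 1 ∷ 1 ∷ 3 ∷ [])
type-1113-impossible A B AB≢0 record
  { degrees    = _∷_ {x = p₁} d₁ (_∷_ {x = p₂} d₂ (_∷_ {x = p₃} d₃ (_∷_ {x = g} d₄ [])))
  ; factorises = factorises
  }
  with u , a , p₁* ← coeff-linear-* p₁ d₁
     | v , b , p₂* ← coeff-linear-* p₂ d₂
     | w , c , p₃* ← coeff-linear-* p₃ d₃ = AB≢0 (trans (cong (A *_) B≡0) (*-zeroʳ A))
  where
  cofactor : ℕ → ℚ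
  cofactor = cubicCoeff (coeff g 0) (coeff g 1) (coeff g 2) (coeff g 3)

  -- `productₚ` ends in `const 1ℚ`, so the innermost factor appears multiplied by 1.
  g≗cofactor : ∀ k → coeff (g *ₚ const 1ℚ) k ≡ cofactor k
  g≗cofactor 0 = *ₚ-identityʳ g 0
  g≗cofactor 1 = *ₚ-identityʳ g 1
  g≗cofactor 2 = *ₚ-identityʳ g 2
  g≗cofactor 3 = *ₚ-identityʳ g 3
  g≗cofactor (suc (suc (suc (suc k)))) =
    trans (*ₚ-identityʳ g (4 ℕ.+ k)) (proj₂ d₄ (s≤s (s≤s (s≤s (s≤s z≤n)))))

  f : ℕ → ℚ
  f = linearTimes u a (linearTimes v b (linearTimes w c cofactor))

  f≗trinomial : ∀ k → f k ≡ trinomialCoeff A B k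
  f≗trinomial k = sym (trans (sym (coeff-trinomial A B k)) (trans (factorises k)
    (trans (p₁* _ k) (linearTimes-cong u a (λ k →
     trans (p₂* _ k) (linearTimes-cong v b (λ k →
     trans (p₃* _ k) (linearTimes-cong w c g≗cofactor k)) k)) k))))

  -- The coefficients of x², ..., x⁶ are 0, 0, 0, 0, 1; at these values the vanishing combination is
  -- `2h₄` itself.
  2h₄≡0 : 2h₄ a b c ≡ 0ℚ
  2h₄≡0 = begin
    2h₄ a b c
      ≡⟨ sym (collapse h₁ h₂ h₃ (2h₄ a b c)) ⟩
    combination 0ℚ 0ℚ 0ℚ 0ℚ 1ℚ
      ≡⟨ sym substitute ⟩
    combination (f 2) (f 3) (f 4) (f 5) (f 6)
      ≡⟨ vanishing-combination a b c u v w (coeff g 0) (coeff g 1) (coeff g 2) (coeff g 3) ⟩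
    0ℚ ∎
    where
    open ≡-Reasoning
    h₁ = a + b + c
    h₂ = a * a + b * b + c * c + a * b + b * c + c * a
    h₃ = a * a * a + b * b * b + c * c * c + a * a * b + a * b * b + b * b * c + b * c * c
         + c * c * a + c * a * a + a * b * c
    combination : ℚ → ℚ → ℚ → ℚ → ℚ → ℚ
    combination f₂ f₃ f₄ f₅ f₆ = s + s + 2h₄ a b c * f₆
      where s = f₂ + h₁ * f₃ + h₂ * f₄ + h₃ * f₅
    collapse : ∀ h₁ h₂ h₃ h →
      0ℚ + h₁ * 0ℚ + h₂ * 0ℚ + h₃ * 0ℚ + (0ℚ + h₁ * 0ℚ + h₂ * 0ℚ + h₃ * 0ℚ) + h * 1ℚ ≡ h
    collapse = solve-∀ ℚ-ring
    substitute : combination (f 2) (f 3) (f 4) (f 5) (f 6) ≡ combination 0ℚ 0ℚ 0ℚ 0ℚ 1ℚ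
    substitute rewrite f≗trinomial 2 | f≗trinomial 3 | f≗trinomial 4 | f≗trinomial 5 | f≗trinomial 6 = refl

  a≡0 : a ≡ 0ℚ
  a≡0 = 2h₄-definite a b c 2h₄≡0

  B≡0 : B ≡ 0ℚ
  B≡0 = begin
    B                   ≡⟨ sym (f≗trinomial 0) ⟩
    - (u * a) * e₀      ≡⟨ cong (λ a → - (u * a) * e₀) a≡0 ⟩
    - (u * 0ℚ) * e₀     ≡⟨ cancel u e₀ ⟩
    0ℚ                  ∎
    where
    open ≡-Reasoning
    e₀ = linearTimes v b (linearTimes w c cofactor) 0
    cancel : ∀ u e → - (u * 0ℚ) * e ≡ 0ℚ
    cancel = solve-∀ ℚ-ring

-- Excluding rational roots by reduction modulo 3.

homogenise-eval : ∀ l {n d r} → ι d * r ≡ ι n →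
  ι (degreePower l d) * eval (map ι l) r ≡ ι (homogenise l n d)
homogenise-eval []      dr≡n = refl
homogenise-eval (a ∷ l) {n} {d} {r} dr≡n = begin
  ι (d ℤ.* D) * (ι a + r * E)                         ≡⟨ cong (_* (ι a + r * E)) (ι-* d D) ⟩
  ι d * ι D * (ι a + r * E)                           ≡⟨ rearrange (ι d) (ι D) (ι a) r E ⟩
  ι a * (ι d * ι D) + ι d * r * (ι D * E)
    ≡⟨ cong₂ _+_ (cong (ι a *_) (sym (ι-* d D))) (cong₂ _*_ dr≡n (homogenise-eval l dr≡n)) ⟩
  ι a * ι (d ℤ.* D) + ι n * ι (homogenise l n d)
    ≡⟨ cong₂ _+_ (sym (ι-* a (d ℤ.* D))) (sym (ι-* n (homogenise l n d))) ⟩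
  ι (a ℤ.* (d ℤ.* D)) + ι (n ℤ.* homogenise l n d)
    ≡⟨ sym (ι-+ (a ℤ.* (d ℤ.* D)) (n ℤ.* homogenise l n d)) ⟩
  ι (homogenise (a ∷ l) n d)                          ∎
  where
  open ≡-Reasoning
  D = degreePower l d
  E = eval (map ι l) r
  rearrange : ∀ d D a r E → d * D * (a + r * E) ≡ a * (d * D) + d * r * (D * E)
  rearrange = solve-∀ ℚ-ring

-- A root n/d in lowest terms is a zero of the form `F`. Its reduction modulo 3 is anisotropic, so 3
-- would divide both n and d.
rootless-mod-3 : ∀ l (F F₃ : ℤ → ℤ → ℤ) →
  (∀ n d → homogenise l n d ≡ d ℤ.* F n d) →
  (∀ {n d n′ d′} → n ≋ n′ [mod + 3 ] → d ≋ d′ [mod + 3 ] → F n d ≋ F₃ n′ d′ [mod + 3 ]) →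
  (∀ (i j : Fin 3) → 3 ℕ.∣ ℤ.∣ F₃ (+ toℕ i) (+ toℕ j) ∣ → toℕ i ≡ 0 × toℕ j ≡ 0) →
  ∀ r → eval (map ι l) r ≢ 0ℚ
rootless-mod-3 l F F₃ homogenise≡dF F≋F₃ anisotropic r@(mkℚ n d-1 n⊥d) root =
  -- The coprimality proof stored in a rational is irrelevant and has to be recomputed; the common
  -- divisor 3 would then equal 1.
  contradiction (Coprimality.recompute n⊥d (∣residue n i n≋i i≡0 , ∣residue d j d≋j j≡0)) λ ()
  where
  d : ℤ
  d = ↧ r

  F≡0 : F n d ≡ 0ℤ
  -- The denominator is positive, so the extra factor d in `homogenise` cancels.
  F≡0 = [ (λ ()) , id ]′ (ℤ.i*j≡0⇒i≡0∨j≡0 d (trans (sym (homogenise≡dF n d)) (ι-injective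
    (trans (sym (homogenise-eval l (ι-denominator-* r)))
      (trans (cong (ι (degreePower l d) *_) root) (*-zeroʳ (ι (degreePower l d))))))))

  i = proj₁ (residue 3 n)
  j = proj₁ (residue 3 d)
  n≋i = proj₂ (residue 3 n)
  d≋j = proj₂ (residue 3 d)

  i≡0∧j≡0 : toℕ i ≡ 0 × toℕ j ≡ 0
  i≡0∧j≡0 = anisotropic i j (≋0⇒∣ (≋-trans (≋-sym (F≋F₃ n≋i d≋j)) (≋-reflexive F≡0)))
  i≡0 = proj₁ i≡0∧j≡0
  j≡0 = proj₂ i≡0∧j≡0

  ∣residue : ∀ a (k : Fin 3) → a ≋ + toℕ k [mod + 3 ] → toℕ k ≡ 0 → 3 ℕ.∣ ℤ.∣ a ∣
  ∣residue a k a≋k k≡0 = ≋0⇒∣ (subst (λ k → a ≋ + k [mod + 3 ]) k≡0 a≋k)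

-- The factorisation of the family over the rationals.

coeff-map-ι : ∀ l k → coeff (map ι l) k ≡ ι (coeffℤ l k)
coeff-map-ι []      k       = refl
coeff-map-ι (a ∷ l) zero    = refl
coeff-map-ι (a ∷ l) (suc k) = coeff-map-ι l k

coeff-map-ι-* : ∀ l {q c} → (∀ k → coeff q k ≡ ι (c k)) →
  ∀ k → coeff (map ι l *ₚ q) k ≡ ι (convolve l c k)
coeff-map-ι-* []      q≗c k       = refl
coeff-map-ι-* (a ∷ l) {q} {c} q≗c zero    = begin
  coeff (map ι (a ∷ l) *ₚ q) 0    ≡⟨ coeff-*ₚ-zero (ι a) (map ι l) q ⟩
  ι a * coeff q 0                 ≡⟨ cong (ι a *_) (q≗c 0) ⟩
  ι a * ι (c 0)                   ≡⟨ sym (ι-* a (c 0)) ⟩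
  ι (a ℤ.* c 0)                   ∎
  where open ≡-Reasoning
coeff-map-ι-* (a ∷ l) {q} {c} q≗c (suc k) = begin
  coeff (map ι (a ∷ l) *ₚ q) (suc k)                          ≡⟨ coeff-*ₚ-suc (ι a) (map ι l) q k ⟩
  ι a * coeff q (suc k) + coeff (map ι l *ₚ q) k
    ≡⟨ cong₂ _+_ (cong (ι a *_) (q≗c (suc k))) (coeff-map-ι-* l q≗c k) ⟩
  ι a * ι (c (suc k)) + ι (convolve l c k)
    ≡⟨ cong (_+ ι (convolve l c k)) (sym (ι-* a (c (suc k)))) ⟩
  ι (a ℤ.* c (suc k)) + ι (convolve l c k)
    ≡⟨ sym (ι-+ (a ℤ.* c (suc k)) (convolve l c k)) ⟩
  ι (a ℤ.* c (suc k) ℤ.+ convolve l c k)                      ∎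
  where open ≡-Reasoning

ι-^ : ∀ i n → ι (i ℤ.^ n) ≡ ι i ^ℚ n
ι-^ i zero    = refl
ι-^ i (suc n) = trans (ι-* i (i ℤ.^ n)) (cong (ι i *_) (ι-^ i n))

trinomial-monic : ∀ A B → Monic (trinomial 6 1 (A , B))
trinomial-monic A B = 6 , (1≢0 , λ { (s≤s (s≤s (s≤s (s≤s (s≤s (s≤s (s≤s z≤n))))))) → refl }) , refl

family-reducibility : ∀ {n} (P : CurvePoint n) →
  HasReducibilityType (trinomial 6 1 (ι (familyA P) , ι (familyB P))) (1 ∷ 2 ∷ 3 ∷ [])
family-reducibility P = record
  { monic       = trinomial-monic (ι (familyA P)) (ι (familyB P))
  ; sorted      = s≤s z≤n ∷ s≤s (s≤s z≤n) ∷ [-]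
  ; factors     = map ι l ∷ map ι q ∷ map ι c ∷ []
  ; irreducible = rootless⇒irreducible l-degree (s≤s z≤n) (s≤s z≤n) (λ { (s≤s ()) })
                ∷ rootless⇒irreducible q-degree (s≤s z≤n) (s≤s (s≤s z≤n)) (λ _ → q-rootless)
                ∷ rootless⇒irreducible c-degree (s≤s z≤n) ℕ.≤-refl (λ _ → c-rootless) ∷ []
  ; degrees     = l-degree ∷ q-degree ∷ c-degree ∷ []
  ; factorises  = λ k → trans (coeff-trinomial _ _ k) (trans (coefficients k) (sym (product k)))
  }
  where
  open CurvePoint P
  Z = z ℤ.* z
  l = linear x Z w
  q = quadratic x Z w
  c = cubic x Z w

  l-degree : HasDegree (map ι l) 1
  l-degree = 1≢0 , λ { (s≤s (s≤s z≤n)) → refl }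
  q-degree : HasDegree (map ι q) 2
  q-degree = 1≢0 , λ { (s≤s (s≤s (s≤s z≤n))) → refl }
  c-degree : HasDegree (map ι c) 3
  c-degree = 1≢0 , λ { (s≤s (s≤s (s≤s (s≤s z≤n)))) → refl }

  q-rootless : ∀ r → eval (map ι q) r ≢ 0ℚ
  q-rootless = rootless-mod-3 q _ _ (homogenise-quadratic (rootProduct x Z w) (ℤ.- rootSum x Z w))
    (quadratic-mod-3 P) anisotropic-quadratic

  c-rootless : ∀ r → eval (map ι c) r ≢ 0ℚ
  c-rootless = rootless-mod-3 c _ _ (homogenise-cubic (cubic₀ x Z w) (cubic₁ x Z w) (cubic₂ x Z w))
    (cubic-mod-3 P) anisotropic-cubic

  product : ∀ k → coeff (productₚ (map ι l ∷ map ι q ∷ map ι c ∷ [])) k ≡ ι (productCoeff x Z w k)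
  product = coeff-map-ι-* l {map ι q *ₚ (map ι c *ₚ const 1ℚ)}
    (coeff-map-ι-* q {map ι c *ₚ const 1ℚ} (λ k → trans (*ₚ-identityʳ (map ι c) k) (coeff-map-ι c k)))

  coefficients : ∀ k → trinomialCoeff (ι (familyA P)) (ι (familyB P)) k ≡
    ι (productCoeff x Z w k)
  -- A and B are by definition coefficients 1 and 0 of the product. Among the others only
  -- coefficient 2 appeals to the curve equation.
  coefficients 0 = refl
  coefficients 1 = refl
  coefficients 2 = cong ι (sym (productCoeff-2 P))
  coefficients 3 = cong ι (sym (productCoeff-3 x Z w))
  coefficients 4 = cong ι (sym (productCoeff-4 x Z w))
  coefficients 5 = cong ι (sym (productCoeff-5 x Z w))
  coefficients 6 = cong ι (sym (productCoeff-6 (rootProduct x Z w) (rootSum x Z w) (rationalRoot x Z w)))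
  coefficients (suc (suc (suc (suc (suc (suc (suc k))))))) = cong ι (sym (productCoeff-above P k))

-- Both numbers have a 2-adic valuation, which zero lacks.
family-nonzero : ∀ {n} (P : CurvePoint n) → ι (familyA P) * ι (familyB P) ≢ 0ℚ
family-nonzero P = *-≢0
  (exactPower-≢0 (familyA-exactPower P) ∘ ι-injective)
  (exactPower-≢0 (familyB-odd P) ∘ ι-injective)

-- Inequivalence under scaling.

-- Both sides acquire the factor c³⁰. Cross-multiplying the invariant A⁶/B⁵ avoids division and lets
-- integer trinomials be compared within the integers.
scaling-invariant : ∀ A B A′ B′ → EquivalentUpToScaling 6 1 (A , B) (A′ , B′) →
  A′ ^ℚ 6 * B ^ℚ 5 ≡ A ^ℚ 6 * B′ ^ℚ 5
scaling-invariant A B _ _ (c , _ , refl , refl) = identity A B c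
  where
  identity : ∀ A B c →
    let A′ = A * (c * (c * (c * (c * (c * 1ℚ)))))
        B′ = B * (c * (c * (c * (c * (c * (c * 1ℚ))))))
    in A′ * (A′ * (A′ * (A′ * (A′ * (A′ * 1ℚ))))) * (B * (B * (B * (B * (B * 1ℚ)))))
       ≡ A * (A * (A * (A * (A * (A * 1ℚ))))) * (B′ * (B′ * (B′ * (B′ * (B′ * 1ℚ)))))
  identity = solve-∀ ℚ-ring

-- The odd values of B do not affect the valuations of the two sides of the invariant, which are
-- therefore 6(3 + n) and 6(3 + m).
family-inequivalent : ∀ {m n} (P : CurvePoint m) (Q : CurvePoint n) →
  EquivalentUpToScaling 6 1 (ι (familyA P) , ι (familyB P))
                            (ι (familyA Q) , ι (familyB Q)) → m ≡ n
family-inequivalent {m} {n} P Q equivalent =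
  sym (ℕ.+-cancelˡ-≡ 3 n m (ℕ.*-cancelˡ-≡ (3 ℕ.+ n) (3 ℕ.+ m) 6
    (ℕ.+-cancelʳ-≡ 0 (6 ℕ.* (3 ℕ.+ n)) (6 ℕ.* (3 ℕ.+ m)) (exactPower-unique
      (invariant-power Q P)
      (subst (ExactPower _) (sym invariant) (invariant-power P Q))))))
  where
  α β : ∀ {n} → CurvePoint n → ℤ
  α = familyA
  β = familyB

  invariant-power : ∀ {m n} (P : CurvePoint m) (Q : CurvePoint n) →
    -- The summand 0 is 5 · 0, contributed by the fifth power of an odd number.
    ExactPower (6 ℕ.* (3 ℕ.+ m) ℕ.+ 0) (α P ℤ.^ 6 ℤ.* β Q ℤ.^ 5)
  invariant-power P Q = exactPower-* (exactPower-^ 6 (familyA-exactPower P)) (exactPower-^ 5 (familyB-odd Q))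

  ι-invariant : ∀ a b → ι (a ℤ.^ 6 ℤ.* b ℤ.^ 5) ≡ ι a ^ℚ 6 * ι b ^ℚ 5
  ι-invariant a b = trans (ι-* (a ℤ.^ 6) (b ℤ.^ 5)) (cong₂ _*_ (ι-^ a 6) (ι-^ b 5))

  invariant : α Q ℤ.^ 6 ℤ.* β P ℤ.^ 5 ≡ α P ℤ.^ 6 ℤ.* β Q ℤ.^ 5
  invariant = ι-injective (trans (ι-invariant (α Q) (β P)) (trans
    (scaling-invariant (ι (α P)) (ι (β P)) (ι (α Q)) (ι (β Q)) equivalent)
    (sym (ι-invariant (α P) (β Q)))))

theorem4p1 : (Σ[ A ∈ (ℕ → ℚ) ] Σ[ B ∈ (ℕ → ℚ) ]
    ((∀ (i : ℕ) → A i * B i ≢ 0ℚ × HasReducibilityType (trinomial 6 1 (A i , B i)) (1 ∷ 2 ∷ 3 ∷ []))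
    × (∀ (i j : ℕ) → i ≢ j → ¬ EquivalentUpToScaling 6 1 (A i , B i) (A j , B j))))
    × (∀ (A B : ℚ) → A * B ≢ 0ℚ → ¬ HasReducibilityType (trinomial 6 1 (A , B)) (1 ∷ 1 ∷ 1 ∷ 3 ∷ []))
theorem4p1 =
  ( (λ i → ι (familyA (curvePoint i)))
  , (λ i → ι (familyB (curvePoint i)))
  , (λ i → family-nonzero (curvePoint i) , family-reducibility (curvePoint i))
  , λ i j i≢j equivalent → i≢j (family-inequivalent (curvePoint i) (curvePoint j) equivalent))
  , type-1113-impossible
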